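{- Let $(I,+,\preceq_I,\ast)$ be a partially ordered commutative ring. Let $x_1,\dots,x_6\in I$ with $x_i\succeq_I x_{i+1}$ for $1\leq i\leq 5$ and $x_1+x_6\succeq_I x_2+x_5\succeq_I x_3+x_4$, and let $n\geq 0$ be an integer. Suppose that the multiplicative inverse $(x_2-x_6)^{ -1}$ exists in $I$ and $(x_2-x_6)^{ -1}\succ_I 0$. Let $a_1,\dots,a_6\in I$ and suppose that for each $i\in\{2,4,6\}$ there is an upper bound $\hat a_i\in I$ of $\{a_i,-a_i\}$ such that $a_1\succeq_I\hat a_2\succeq_I a_5\succeq_I\hat a_6\succeq_I 0$ and $a_3\succeq_I\hat a_4\succeq_I 0$. Then $$\sum_{i=1}^6 a_i\ast\prod_{\substack{1\leq j\leq 6\\ j\neq i}}(x_i-x_j)^n\succeq_I 0,$$ where the product is taken with respect to $\ast$.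
   Context: A partially ordered Abelian group $(I,+,\preceq_I)$ is an Abelian group with a partial order such that $x+z\preceq_I y+z\Leftrightarrow x\preceq_I y$ for all $x,y,z\in I$. A partially ordered commutative ring $(I,+,\preceq_I,\ast)$ is a partially ordered Abelian group together with an operation $\ast:I\times I\to I$ that is associative, commutative, distributive over $+$, nonnegativity-preserving ($x\succeq_I 0$ and $y\succeq_I 0$ imply $x\ast y\succeq_I 0$), and has an identity element in $I$. Powers $x^n$ and inverses are with respect to $\ast$. An element $u$ is an upper bound of $S\subset I$ if $u\succeq_I s$ for all $s\in S$. -}

module Defs where

open import Level using (Level; suc; _⊔_)
open import Algebra.Core using (Op₁; Op₂)
open import Algebra.Bundles using (CommutativeRing; Semiring)
open import Algebra.Structures using (IsCommutativeRing)
import Algebra.Definitions as AlgebraDefinitions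
import Algebra.Definitions.RawSemiring as RawSemiringDefinitions
open import Data.Sum.Base using (_⊎_)
open import Function.Bundles using (_⇔_)
open import Relation.Binary.Bundles using (Poset)
open import Relation.Binary.Core using (Rel)
import Relation.Binary.Properties.Poset as PosetProperties
open import Relation.Binary.Structures using (IsPartialOrder)
open import Relation.Unary using (Pred; _∈_)

record IsPartiallyOrderedCommutativeRing
  {c ℓ₁ ℓ₂ : Level} {I : Set c} (_≈_ : Rel I ℓ₁) (_≤_ : Rel I ℓ₂)
  (_+_ _*_ : Op₂ I) (-_ : Op₁ I) (0# 1# : I) : Set (c ⊔ ℓ₁ ⊔ ℓ₂) where
  field
    isCommutativeRing : IsCommutativeRing _≈_ _+_ _*_ -_ 0# 1#
    isPartialOrder    : IsPartialOrder _≈_ _≤_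
    +-translation     : ∀ x y z → ((x + z) ≤ (y + z)) ⇔ (x ≤ y)
    *-nonNegative     : ∀ x y → 0# ≤ x → 0# ≤ y → 0# ≤ (x * y)

record PartiallyOrderedCommutativeRing (c ℓ₁ ℓ₂ : Level) : Set (suc (c ⊔ ℓ₁ ⊔ ℓ₂)) where
  infix  8 -_
  infixl 7 _*_
  infixl 6 _+_
  infix  4 _≈_ _≤_
  field
    Carrier : Set c
    _≈_     : Rel Carrier ℓ₁
    _≤_     : Rel Carrier ℓ₂
    _+_ _*_ : Op₂ Carrier
    -_      : Op₁ Carrier
    0# 1#   : Carrier
    isPartiallyOrderedCommutativeRing :
      IsPartiallyOrderedCommutativeRing _≈_ _≤_ _+_ _*_ -_ 0# 1#

  open IsPartiallyOrderedCommutativeRing isPartiallyOrderedCommutativeRing public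

  commutativeRing : CommutativeRing c ℓ₁
  commutativeRing = record { isCommutativeRing = isCommutativeRing }

  open CommutativeRing commutativeRing public using (_-_; semiring)

  poset : Poset c ℓ₁ ℓ₂
  poset = record { isPartialOrder = isPartialOrder }

  open Poset poset public using (_≥_)

  -- x < y means x ≤ y and not x ≈ y.
  open PosetProperties poset public using (_<_)

  infix 4 _>_
  _>_ : Rel Carrier (ℓ₁ ⊔ ℓ₂)
  x > y = y < x

  open RawSemiringDefinitions (Semiring.rawSemiring semiring) public
    using (sum; product; _^_)

  Invertible : Carrier → Set (c ⊔ ℓ₁)
  Invertible = AlgebraDefinitions.Invertible _≈_ 1# _*_

  IsUpperBound : ∀ {ℓ : Level} → Pred Carrier ℓ → Carrier → Set (c ⊔ ℓ ⊔ ℓ₂)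
  IsUpperBound S u = ∀ s → s ∈ S → u ≥ s

  -- Membership is up to _≈_, so Relation.Unary's singletons (which use _≡_) do not fit.
  ｛_,_｝ : Carrier → Carrier → Pred Carrier ℓ₁
  ｛ x , y ｝ s = s ≈ x ⊎ s ≈ y

-- Put pᵢ = Π_{j≠i} |xᵢ − xⱼ|. The i-th product is pᵢⁿ for odd i and (−pᵢ)ⁿ for even i, so bounding
-- the even terms by âᵢ pᵢⁿ leaves â₂ p₂ⁿ + â₆ p₆ⁿ ≤ a₁ p₁ⁿ + a₅ p₅ⁿ and â₄ p₄ⁿ ≤ a₃ p₃ⁿ.
-- All xᵢ − xⱼ with i < j are sums of the five nonnegative elements x₅ − x₆, x₄ − x₅, x₃ − x₄,
-- (x₁ + x₆) − (x₂ + x₅) and (x₂ + x₅) − (x₃ + x₄). As polynomials in these, p₃ − p₄, p₆ − p₅,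
-- p₁ − p₆ and p₁ + p₅ − p₂ − p₆ have nonnegative coefficients, and convexity of t ↦ tⁿ turns the
-- last three into p₂ⁿ + p₆ⁿ ≤ p₁ⁿ + p₅ⁿ. The weights then enter by Abel summation. The inverse of
-- x₂ − x₆ serves only to give 0 ≤ 1.
module Submission where

open import Defs
open import Algebra.Bundles using (CommutativeRing)
import Algebra.Properties.CommutativeSemiring.Exp
import Algebra.Properties.Ring
import Algebra.Solver.Ring.NaturalCoefficients.Default
open import Level using (Level)
open import Data.Nat.Base using (ℕ; zero; suc)
open import Data.Fin.Base using (Fin; zero; suc; inject₁)
open import Data.Fin.Patterns using (0F; 1F; 2F; 3F; 4F; 5F)
open import Data.List.Base using (List; []; _∷_)
open import Data.Product.Base using (_×_; _,_; proj₁)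
open import Data.Sum.Base using (_⊎_; inj₁; inj₂)
open import Data.Vec.Base using (Vec; []; _∷_; lookup)
open import Data.Vec.Functional using (Vector; removeAt)
open import Function.Base using (_∘_)
open import Function.Bundles using (Equivalence)
open import Relation.Binary.Bundles using (Poset)
import Relation.Binary.Reasoning.PartialOrder
import Relation.Binary.Reasoning.Setoid

module PartiallyOrderedCommutativeRingProperties
  {c ℓ₁ ℓ₂ : Level} (R : PartiallyOrderedCommutativeRing c ℓ₁ ℓ₂) where

  open PartiallyOrderedCommutativeRing R
  open CommutativeRing commutativeRing using
    ( refl; sym; trans; setoid; ring; commutativeSemiring
    ; +-congˡ; +-congʳ; +-comm; +-assoc; +-identityˡ; +-identityʳ
    ; -‿inverseˡ; -‿inverseʳ; -‿cong; *-cong; *-congˡ; *-congʳ; *-comm; *-identityˡ; distribʳ)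
  open Algebra.Properties.Ring ring
    using (-‿distribˡ-*; -‿distribʳ-*; -‿involutive; ⁻¹-anti-homo‿-; +-cancelʳ)
  open Algebra.Properties.CommutativeSemiring.Exp commutativeSemiring
    using (^-congˡ; ^-distrib-*)
  open Algebra.Solver.Ring.NaturalCoefficients.Default commutativeSemiring
    using (Polynomial; op; con; var; _:^_; :-_; _:+_; _:*_; _:=_; solve; prove; ⟦_⟧; [+]; [*])
  open Poset poset using () renaming
    (refl to ≤-refl; trans to ≤-trans; ≤-respʳ-≈ to ≤-respʳ; ≤-respˡ-≈ to ≤-respˡ)
  module ≤-Reasoning = Relation.Binary.Reasoning.PartialOrder poset
  module ≈-Reasoning = Relation.Binary.Reasoning.Setoid setoid

  private variable
    u v w x y z x′ y′ : Carrier

  -- Order arithmetic in the ring.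

  +-monoˡ-≤ : ∀ z → x ≤ y → x + z ≤ y + z
  +-monoˡ-≤ z = Equivalence.from (+-translation _ _ z)

  +-monoʳ-≤ : ∀ z → x ≤ y → z + x ≤ z + y
  +-monoʳ-≤ z x≤y = ≤-respˡ (+-comm _ z) (≤-respʳ (+-comm _ z) (+-monoˡ-≤ z x≤y))

  +-mono-≤ : x ≤ y → x′ ≤ y′ → x + x′ ≤ y + y′
  +-mono-≤ x≤y x′≤y′ = ≤-trans (+-monoˡ-≤ _ x≤y) (+-monoʳ-≤ _ x′≤y′)

  +-nonNegative : 0# ≤ x → 0# ≤ y → 0# ≤ x + y
  +-nonNegative 0≤x 0≤y = ≤-respˡ (+-identityˡ 0#) (+-mono-≤ 0≤x 0≤y)

  y≈[y-x]+x : ∀ x y → y ≈ (y - x) + x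
  y≈[y-x]+x x y = begin
    y              ≈⟨ +-identityʳ y ⟨
    y + 0#         ≈⟨ +-congˡ (-‿inverseˡ x) ⟨
    y + (- x + x)  ≈⟨ +-assoc y (- x) x ⟨
    (y - x) + x    ∎
    where open ≈-Reasoning

  x≤y⇒0≤y-x : x ≤ y → 0# ≤ y - x
  x≤y⇒0≤y-x {x} x≤y = ≤-respˡ (-‿inverseʳ x) (+-monoˡ-≤ (- x) x≤y)

  -- Reduces an inequality to an identity with an explicit nonnegative summand; every comparison of
  -- the products is obtained this way.
  0≤w∧y≈w+x⇒x≤y : 0# ≤ w → y ≈ w + x → x ≤ y
  0≤w∧y≈w+x⇒x≤y 0≤w y≈w+x =
    ≤-respʳ (sym y≈w+x) (≤-respˡ (+-identityˡ _) (+-monoˡ-≤ _ 0≤w))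

  *-monoˡ-≤ : 0# ≤ z → x ≤ y → x * z ≤ y * z
  *-monoˡ-≤ {z} {x} {y} 0≤z x≤y =
    0≤w∧y≈w+x⇒x≤y (*-nonNegative _ _ (x≤y⇒0≤y-x x≤y) 0≤z)
      (trans (*-congʳ (y≈[y-x]+x x y)) (distribʳ z _ x))

  *-monoʳ-≤ : 0# ≤ z → x ≤ y → z * x ≤ z * y
  *-monoʳ-≤ {z} 0≤z x≤y = ≤-respˡ (*-comm _ z) (≤-respʳ (*-comm _ z) (*-monoˡ-≤ 0≤z x≤y))

  -- Powers of products, signs and differences.

  product-^ : ∀ {m} (f : Vector Carrier m) n → product (λ j → f j ^ n) ≈ product f ^ n
  product-^ {zero}  f zero    = refl
  product-^ {zero}  f (suc n) = trans (product-^ f n) (sym (*-identityˡ _))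
  product-^ {suc m} f n =
    trans (*-congˡ (product-^ (f ∘ suc) n)) (sym (^-distrib-* (f zero) (product (f ∘ suc)) n))

  -x*y≈-[x*y] : x ≈ - u → y ≈ v → x * y ≈ - (u * v)
  -x*y≈-[x*y] x≈-u y≈v = trans (*-cong x≈-u y≈v) (sym (-‿distribˡ-* _ _))

  -x*-y≈x*y : x ≈ - u → y ≈ - v → x * y ≈ u * v
  -x*-y≈x*y x≈-u y≈-v =
    trans (-x*y≈-[x*y] x≈-u y≈-v) (trans (-‿cong (sym (-‿distribʳ-* _ _))) (-‿involutive _))

  [-x]^n≈±x^n : ∀ x n → ((- x) ^ n ≈ x ^ n) ⊎ ((- x) ^ n ≈ - (x ^ n))
  [-x]^n≈±x^n x zero    = inj₁ refl
  [-x]^n≈±x^n x (suc n) with [-x]^n≈±x^n x n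
  ... | inj₁ even = inj₂ (-x*y≈-[x*y] refl even)
  ... | inj₂ odd  = inj₁ (-x*-y≈x*y refl odd)

  difference⁺ : x ≈ w + y → x - y ≈ w
  difference⁺ {x} {w} {y} x≈w+y = +-cancelʳ y _ _ (trans (sym (y≈[y-x]+x y x)) x≈w+y)

  difference⁻ : x ≈ w + y → y - x ≈ - w
  difference⁻ {x} {w} {y} x≈w+y =
    trans (sym (⁻¹-anti-homo‿- x y)) (-‿cong (difference⁺ x≈w+y))

  chain : x ≈ u + y → y ≈ v + z → x ≈ (u + v) + z
  chain x≈u+y y≈v+z = trans x≈u+y (trans (+-congˡ y≈v+z) (sym (+-assoc _ _ _)))

  -- Used for `x₁ - x₂`, bounded below by `x₅ - x₆`, and for `x₂ - x₃`, bounded below by `x₄ - x₅`;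
  -- `v` is the slack in the hypothesis on the sums.
  outer-gap : x′ ≈ u + y′ → x + y′ ≈ v + (y + x′) → x ≈ (u + v) + y
  outer-gap {x′} {u} {y′} {x} {v} {y} x′≈u+y′ eq = +-cancelʳ y′ _ _ (begin
    x + y′              ≈⟨ eq ⟩
    v + (y + x′)        ≈⟨ +-congˡ (+-congˡ x′≈u+y′) ⟩
    v + (y + (u + y′))  ≈⟨ solve 4 (λ u v y y′ → v :+ (y :+ (u :+ y′)) := ((u :+ v) :+ y) :+ y′) refl u v y y′ ⟩
    ((u + v) + y) + y′  ∎)
    where open ≈-Reasoning

  -- Monotonicity and convexity of powers, positivity of polynomials.

  module _ (0≤1 : 0# ≤ 1#) where

    ^-nonNegative : ∀ n → 0# ≤ x → 0# ≤ x ^ n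
    ^-nonNegative zero    0≤x = 0≤1
    ^-nonNegative (suc n) 0≤x = *-nonNegative _ _ 0≤x (^-nonNegative n 0≤x)

    ^-monoˡ-≤ : ∀ n → 0# ≤ x → x ≤ y → x ^ n ≤ y ^ n
    ^-monoˡ-≤ zero    0≤x x≤y = ≤-refl
    ^-monoˡ-≤ (suc n) 0≤x x≤y = ≤-trans
      (*-monoˡ-≤ (^-nonNegative n 0≤x) x≤y)
      (*-monoʳ-≤ (≤-trans 0≤x x≤y) (^-monoˡ-≤ n 0≤x x≤y))

    -- The points `v + w` and `u + w` lie between `w` and `v + (u + w)` and have the same sum as
    -- these endpoints. Once one factor is split off each power, the parts with `u` and `v` follow
    -- from monotonicity and the part with `w` by induction.
    ^-convex : ∀ n → 0# ≤ u → 0# ≤ v → 0# ≤ w →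
               (v + w) ^ n + (u + w) ^ n ≤ (v + (u + w)) ^ n + w ^ n
    ^-convex         zero    0≤u 0≤v 0≤w = ≤-refl
    ^-convex {u} {v} {w} (suc n) 0≤u 0≤v 0≤w = begin
      (v + w) * B + (u + w) * D
        ≈⟨ solve 5 (λ u v w B D →
             (v :+ w) :* B :+ (u :+ w) :* D := (v :* B :+ u :* D) :+ w :* (B :+ D))
             refl u v w B D ⟩
      (v * B + u * D) + w * (B + D)
        ≤⟨ +-mono-≤
             (+-mono-≤ (*-monoʳ-≤ 0≤v (^-monoˡ-≤ n (+-nonNegative 0≤v 0≤w) v+w≤))
                       (*-monoʳ-≤ 0≤u (^-monoˡ-≤ n (+-nonNegative 0≤u 0≤w) u+w≤)))
             (*-monoʳ-≤ 0≤w (^-convex n 0≤u 0≤v 0≤w)) ⟩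
      (v * A + u * A) + w * (A + C)
        ≈⟨ solve 5 (λ u v w A C →
             (v :* A :+ u :* A) :+ w :* (A :+ C) := (v :+ (u :+ w)) :* A :+ w :* C)
             refl u v w A C ⟩
      (v + (u + w)) * A + w * C ∎
      where
      open ≤-Reasoning
      A = (v + (u + w)) ^ n
      B = (v + w) ^ n
      C = w ^ n
      D = (u + w) ^ n
      u+w≤ : u + w ≤ v + (u + w)
      u+w≤ = 0≤w∧y≈w+x⇒x≤y 0≤v refl
      v+w≤ : v + w ≤ v + (u + w)
      v+w≤ = 0≤w∧y≈w+x⇒x≤y 0≤u
        (solve 3 (λ u v w → v :+ (u :+ w) := u :+ (v :+ w)) refl u v w)

    -- In this solver the coefficients are natural numbers and :-_ denotes the identity.
    ⟦⟧-nonNegative : ∀ {m} (p : Polynomial m) (ρ : Vec Carrier m) →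
                     (∀ i → 0# ≤ lookup ρ i) → 0# ≤ ⟦ p ⟧ ρ
    ⟦⟧-nonNegative (op [+] p q) ρ 0≤ρ = +-nonNegative (⟦⟧-nonNegative p ρ 0≤ρ) (⟦⟧-nonNegative q ρ 0≤ρ)
    ⟦⟧-nonNegative (op [*] p q) ρ 0≤ρ = *-nonNegative _ _ (⟦⟧-nonNegative p ρ 0≤ρ) (⟦⟧-nonNegative q ρ 0≤ρ)
    ⟦⟧-nonNegative (con zero)          ρ 0≤ρ = ≤-refl
    ⟦⟧-nonNegative (con (suc zero))    ρ 0≤ρ = 0≤1
    ⟦⟧-nonNegative (con (suc (suc k))) ρ 0≤ρ = +-nonNegative (⟦⟧-nonNegative (con (suc k)) ρ 0≤ρ) 0≤1
    ⟦⟧-nonNegative (var i)      ρ 0≤ρ = 0≤ρ i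
    ⟦⟧-nonNegative (p :^ n)     ρ 0≤ρ = ^-nonNegative n (⟦⟧-nonNegative p ρ 0≤ρ)
    ⟦⟧-nonNegative (:- p)       ρ 0≤ρ = ⟦⟧-nonNegative p ρ 0≤ρ

    -- The sum is `(y + x) * z ^ n` or `(y - x) * z ^ n`, according to the sign of `(- z) ^ n`; the
    -- two halves of the upper bound cover the two cases.
    absorb-sign : ∀ n → IsUpperBound ｛ x , - x ｝ y → 0# ≤ z → 0# ≤ y * z ^ n + x * (- z) ^ n
    absorb-sign {x} {y} {z} n x≤y 0≤z with [-x]^n≈±x^n z n
    ... | inj₁ even = ≤-respʳ
      (trans (distribʳ _ _ _) (+-congˡ (*-congˡ (sym even))))
      (*-nonNegative _ _ (≤-respˡ (-‿inverseˡ x) (+-monoˡ-≤ x (x≤y _ (inj₂ refl)))) (^-nonNegative n 0≤z))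
    ... | inj₂ odd = ≤-respʳ
      (trans (distribʳ _ _ _) (+-congˡ
        (trans (sym (-‿distribˡ-* _ _)) (trans (-‿distribʳ-* _ _) (*-congˡ (sym odd))))))
      (*-nonNegative _ _ (x≤y⇒0≤y-x (x≤y _ (inj₁ refl))) (^-nonNegative n 0≤z))

  -- Raising `â₆` to `a₅` and writing `â₂` as `s + a₅` leaves `s` times the first comparison plus
  -- `a₅` times the comparison of sums, so `P₆` and `P₅` are never compared alone.
  weighted-sum-≤ : ∀ {â₂ â₆ a₁ a₅ P₁ P₂ P₅ P₆} →
    0# ≤ P₁ → 0# ≤ P₆ → P₂ ≤ P₁ → P₂ + P₆ ≤ P₁ + P₅ →
    â₂ ≤ a₁ → a₅ ≤ â₂ → â₆ ≤ a₅ → 0# ≤ â₆ →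
    â₂ * P₂ + â₆ * P₆ ≤ a₁ * P₁ + a₅ * P₅
  weighted-sum-≤ {â₂} {â₆} {a₁} {a₅} {P₁} {P₂} {P₅} {P₆}
    0≤P₁ 0≤P₆ P₂≤P₁ P₂+P₆≤P₁+P₅ â₂≤a₁ a₅≤â₂ â₆≤a₅ 0≤â₆ = begin
    â₂ * P₂ + â₆ * P₆             ≤⟨ +-monoʳ-≤ _ (*-monoˡ-≤ 0≤P₆ â₆≤a₅) ⟩
    â₂ * P₂ + a₅ * P₆             ≈⟨ split P₂ P₆ ⟩
    s * P₂ + a₅ * (P₂ + P₆)       ≤⟨ +-mono-≤ (*-monoʳ-≤ (x≤y⇒0≤y-x a₅≤â₂) P₂≤P₁)
                                       (*-monoʳ-≤ (≤-trans 0≤â₆ â₆≤a₅) P₂+P₆≤P₁+P₅) ⟩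
    s * P₁ + a₅ * (P₁ + P₅)       ≈⟨ split P₁ P₅ ⟨
    â₂ * P₁ + a₅ * P₅             ≤⟨ +-monoˡ-≤ _ (*-monoˡ-≤ 0≤P₁ â₂≤a₁) ⟩
    a₁ * P₁ + a₅ * P₅             ∎
    where
    open ≤-Reasoning
    s = â₂ - a₅
    split : ∀ P Q → â₂ * P + a₅ * Q ≈ s * P + a₅ * (P + Q)
    split P Q = trans (+-congʳ (*-congʳ (y≈[y-x]+x a₅ â₂)))
      (solve 4 (λ s a P Q → (s :+ a) :* P :+ a :* Q := s :* P :+ a :* (P :+ Q)) refl s a₅ P Q)

  -- Differences and products as polynomials in the five nonnegative elements.

  Poly : Set
  Poly = Polynomial 5

  -- The variables stand for x₅ − x₆, (x₁ + x₆) − (x₂ + x₅), x₄ − x₅,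
  -- (x₂ + x₅) − (x₃ + x₄) and x₃ − x₄.
  β γ δ ε ζ : Poly
  β = var 0F
  γ = var 1F
  δ = var 2F
  ε = var 3F
  ζ = var 4F

  -- `dᵢⱼ` represents `xᵢ - xⱼ`. Longer gaps are nested to the left, the shape that `chain` yields.
  d₁₂ d₂₃ d₃₄ d₄₅ d₅₆ d₄₆ d₃₅ d₃₆ d₂₄ d₂₅ d₂₆ d₁₃ d₁₄ d₁₅ d₁₆ : Poly
  d₁₂ = β :+ γ
  d₂₃ = δ :+ ε
  d₃₄ = ζ
  d₄₅ = δ
  d₅₆ = β
  d₄₆ = d₄₅ :+ d₅₆
  d₃₅ = d₃₄ :+ d₄₅
  d₃₆ = d₃₅ :+ d₅₆
  d₂₄ = d₂₃ :+ d₃₄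
  d₂₅ = d₂₄ :+ d₄₅
  d₂₆ = d₂₅ :+ d₅₆
  d₁₃ = d₁₂ :+ d₂₃
  d₁₄ = d₁₃ :+ d₃₄
  d₁₅ = d₁₄ :+ d₄₅
  d₁₆ = d₁₅ :+ d₅₆

  -- The order of the factors and the final `con 1` copy the unfolding of `product` after
  -- `removeAt`.
  p₁ p₂ p₃ p₄ p₅ p₆ : Poly
  p₁ = d₁₂ :* (d₁₃ :* (d₁₄ :* (d₁₅ :* (d₁₆ :* con 1))))
  p₂ = d₁₂ :* (d₂₃ :* (d₂₄ :* (d₂₅ :* (d₂₆ :* con 1))))
  p₃ = d₁₃ :* (d₂₃ :* (d₃₄ :* (d₃₅ :* (d₃₆ :* con 1))))
  p₄ = d₁₄ :* (d₂₄ :* (d₃₄ :* (d₄₅ :* (d₄₆ :* con 1))))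
  p₅ = d₁₅ :* (d₂₅ :* (d₃₅ :* (d₄₅ :* (d₅₆ :* con 1))))
  p₆ = d₁₆ :* (d₂₆ :* (d₃₆ :* (d₄₆ :* (d₅₆ :* con 1))))

  -- excess ((s₁ , t₁) ∷ … ∷ (sₖ , tₖ) ∷ []) is Π (sᵢ + tᵢ) − Π sᵢ, written without subtraction.
  excess : List (Poly × Poly) → Poly
  excess []             = con 0
  excess ((s , t) ∷ ps) = t :* enlarged ps :+ s :* excess ps
    where
    enlarged : List (Poly × Poly) → Poly
    enlarged []             = con 1
    enlarged ((s , t) ∷ ps) = (s :+ t) :* enlarged ps

  -- Each difference is a polynomial with natural coefficients, hence nonnegative by its form alone.
  p₆-p₅ p₁-p₆ p₃-p₄ p₁+p₅-p₂-p₆ : Poly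
  p₆-p₅ = d₅₆ :* excess ((d₁₅ , β) ∷ (d₂₅ , β) ∷ (d₃₅ , β) ∷ (d₄₅ , β) ∷ [])
  -- The reflection of indices `i ↦ 7 - i` pairs `d₁₂`, `d₁₃`, `d₁₄`, `d₁₅` with `d₅₆`, `d₄₆`,
  -- `d₃₆`, `d₂₆`.
  p₁-p₆ = d₁₆ :* excess ((d₅₆ , γ) ∷ (d₄₆ , γ :+ ε) ∷ (d₃₆ , γ :+ ε) ∷ (d₂₆ , γ) ∷ [])
  -- d₁₃ d₃₆ − d₁₄ d₄₆ = ζ (γ + ε) and d₂₃ d₃₅ − d₂₄ d₄₅ = ζ ε.
  p₃-p₄ = d₃₄ :* excess ((d₁₄ :* d₄₆ , ζ :* (γ :+ ε)) ∷ (d₂₄ :* d₄₅ , ζ :* ε) ∷ [])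
  -- p₁ − p₂ = (γ + β) X and p₆ − p₅ = β Y, where X − Y is the factor of β below and
  -- W = d₂₃ d₂₄ − d₃₅ d₄₅.
  p₁+p₅-p₂-p₆ =
    γ :* X :+ β :* (d₁₆ :* T :+ d₂₅ :* d₃₅ :* d₄₅ :* γ :+ d₂₆ :* (d₁₆ :* β :* (ε :+ ε) :+ (d₁₂ :+ β) :* W))
    where
    X = excess ((d₂₃ , d₁₂) ∷ (d₂₄ , d₁₂) ∷ (d₂₅ , d₁₂) ∷ (d₂₆ , d₁₂) ∷ [])
    T = excess ((d₂₃ :+ β , γ) ∷ (d₂₄ :+ β , γ) ∷ (d₂₅ :+ β , γ) ∷ [])
    W = excess ((d₄₅ , ε) ∷ (d₃₅ , ε) ∷ [])

  p₆≈ : ∀ ρ → ⟦ p₆ ⟧ ρ ≈ ⟦ p₆-p₅ :+ p₅ ⟧ ρ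
  p₆≈ ρ = prove ρ p₆ (p₆-p₅ :+ p₅) refl

  p₁≈ : ∀ ρ → ⟦ p₁ ⟧ ρ ≈ ⟦ p₁-p₆ :+ p₆ ⟧ ρ
  p₁≈ ρ = prove ρ p₁ (p₁-p₆ :+ p₆) refl

  p₃≈ : ∀ ρ → ⟦ p₃ ⟧ ρ ≈ ⟦ p₃-p₄ :+ p₄ ⟧ ρ
  p₃≈ ρ = prove ρ p₃ (p₃-p₄ :+ p₄) refl

  -- The left side is the element whose sum with `p₆` equals `p₁ + p₅`, which is what convexity
  -- calls for.
  p₁-p₆+p₅≈ : ∀ ρ → ⟦ p₁-p₆ :+ p₅ ⟧ ρ ≈ ⟦ p₁+p₅-p₂-p₆ :+ p₂ ⟧ ρ
  p₁-p₆+p₅≈ ρ = prove ρ (p₁-p₆ :+ p₅) (p₁+p₅-p₂-p₆ :+ p₂) refl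

  -- Inequalities between the products and their powers.

  module Gaps (0≤1 : 0# ≤ 1#) (ρ : Vec Carrier 5) (0≤ρ : ∀ i → 0# ≤ lookup ρ i) where

    0≤⟦_⟧ : ∀ p → 0# ≤ ⟦ p ⟧ ρ
    0≤⟦ p ⟧ = ⟦⟧-nonNegative 0≤1 p ρ 0≤ρ

    p₄≤p₃ : ⟦ p₄ ⟧ ρ ≤ ⟦ p₃ ⟧ ρ
    p₄≤p₃ = 0≤w∧y≈w+x⇒x≤y 0≤⟦ p₃-p₄ ⟧ (p₃≈ ρ)

    p₅≤p₆ : ⟦ p₅ ⟧ ρ ≤ ⟦ p₆ ⟧ ρ
    p₅≤p₆ = 0≤w∧y≈w+x⇒x≤y 0≤⟦ p₆-p₅ ⟧ (p₆≈ ρ)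

    p₂≤p₁-p₆+p₅ : ⟦ p₂ ⟧ ρ ≤ ⟦ p₁-p₆ :+ p₅ ⟧ ρ
    p₂≤p₁-p₆+p₅ = 0≤w∧y≈w+x⇒x≤y 0≤⟦ p₁+p₅-p₂-p₆ ⟧ (p₁-p₆+p₅≈ ρ)

    p₂≤p₁ : ⟦ p₂ ⟧ ρ ≤ ⟦ p₁ ⟧ ρ
    p₂≤p₁ = ≤-trans p₂≤p₁-p₆+p₅ (≤-respʳ (sym (p₁≈ ρ)) (+-monoʳ-≤ _ p₅≤p₆))

    -- First `p₂` is raised to `s + t`. Then `s + t` and `p₆` are the inner points of `^-convex`,
    -- with endpoints `p₅` and `p₁`.
    p₂^n+p₆^n≤p₁^n+p₅^n : ∀ n → ⟦ p₂ ⟧ ρ ^ n + ⟦ p₆ ⟧ ρ ^ n ≤ ⟦ p₁ ⟧ ρ ^ n + ⟦ p₅ ⟧ ρ ^ n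
    p₂^n+p₆^n≤p₁^n+p₅^n n = begin
      ⟦ p₂ ⟧ ρ ^ n + ⟦ p₆ ⟧ ρ ^ n     ≤⟨ +-monoˡ-≤ _ (^-monoˡ-≤ 0≤1 n 0≤⟦ p₂ ⟧ p₂≤p₁-p₆+p₅) ⟩
      (s + t) ^ n + ⟦ p₆ ⟧ ρ ^ n      ≈⟨ +-congˡ (^-congˡ n (p₆≈ ρ)) ⟩
      (s + t) ^ n + (r + t) ^ n       ≤⟨ ^-convex 0≤1 n 0≤⟦ p₆-p₅ ⟧ 0≤⟦ p₁-p₆ ⟧ 0≤⟦ p₅ ⟧ ⟩
      (s + (r + t)) ^ n + t ^ n       ≈⟨ +-congʳ (^-congˡ n (trans (p₁≈ ρ) (+-congˡ (p₆≈ ρ)))) ⟨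
      ⟦ p₁ ⟧ ρ ^ n + ⟦ p₅ ⟧ ρ ^ n     ∎
      where
      open ≤-Reasoning
      r = ⟦ p₆-p₅ ⟧ ρ
      s = ⟦ p₁-p₆ ⟧ ρ
      t = ⟦ p₅ ⟧ ρ

theorem13 :
    ∀ {c ℓ₁ ℓ₂ : Level} (R : PartiallyOrderedCommutativeRing c ℓ₁ ℓ₂) →
    let open PartiallyOrderedCommutativeRing R in
    (x : Vector Carrier 6) →
    let x₁ = x 0F
        x₂ = x 1F
        x₃ = x 2F
        x₄ = x 3F
        x₅ = x 4F
        x₆ = x 5F
    in
    (∀ (i : Fin 5) → x (inject₁ i) ≥ x (suc i)) →
    x₁ + x₆ ≥ x₂ + x₅ →
    x₂ + x₅ ≥ x₃ + x₄ →
    (n : ℕ) →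
    ([x₂-x₆]⁻¹ : Invertible (x₂ - x₆)) →
    proj₁ [x₂-x₆]⁻¹ > 0# →
    (a : Vector Carrier 6) →
    let a₁ = a 0F
        a₂ = a 1F
        a₃ = a 2F
        a₄ = a 3F
        a₅ = a 4F
        a₆ = a 5F
    in
    (â₂ â₄ â₆ : Carrier) →
    IsUpperBound ｛ a₂ , - a₂ ｝ â₂ →
    IsUpperBound ｛ a₄ , - a₄ ｝ â₄ →
    IsUpperBound ｛ a₆ , - a₆ ｝ â₆ →
    a₁ ≥ â₂ → â₂ ≥ a₅ → a₅ ≥ â₆ → â₆ ≥ 0# →
    a₃ ≥ â₄ → â₄ ≥ 0# →
    -- removeAt v i drops the i-th entry of v, leaving the factors with j ≠ i.
    sum (λ i → a i * product (removeAt (λ j → (x i - x j) ^ n) i)) ≥ 0#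
theorem13 R x x↓ x₁+x₆≥x₂+x₅ x₂+x₅≥x₃+x₄ n (inv , inv-inverse) inv>0 a â₂ â₄ â₆
  a₂≤â₂ a₄≤â₄ a₆≤â₆ a₁≥â₂ â₂≥a₅ a₅≥â₆ â₆≥0 a₃≥â₄ â₄≥0 = begin
    0#
      -- Each even term is offset by its bound `âᵢ` times the power of `pᵢ`.
      ≤⟨ +-nonNegative (absorb-sign 0≤1 n a₂≤â₂ 0≤⟦ p₂ ⟧)
           (+-nonNegative (absorb-sign 0≤1 n a₄≤â₄ 0≤⟦ p₄ ⟧) (absorb-sign 0≤1 n a₆≤â₆ 0≤⟦ p₆ ⟧)) ⟩
    (â₂ * P p₂ + a 1F * Q p₂) + ((â₄ * P p₄ + a 3F * Q p₄) + (â₆ * P p₆ + a 5F * Q p₆))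
      ≈⟨ solve 6 (λ A B C D E F →
           (A :+ B) :+ ((C :+ D) :+ (E :+ F)) := ((A :+ E) :+ C) :+ (B :+ (D :+ F)))
           refl _ _ _ _ _ _ ⟩
    ((â₂ * P p₂ + â₆ * P p₆) + â₄ * P p₄) + (a 1F * Q p₂ + (a 3F * Q p₄ + a 5F * Q p₆))
      -- Terms 1 and 5 dominate the offsets for 2 and 6; term 3 dominates the offset for 4.
      ≤⟨ +-monoˡ-≤ _ (+-mono-≤
           (weighted-sum-≤ 0≤P[ p₁ ] 0≤P[ p₆ ] (^-monoˡ-≤ 0≤1 n 0≤⟦ p₂ ⟧ p₂≤p₁)
             (p₂^n+p₆^n≤p₁^n+p₅^n n) a₁≥â₂ â₂≥a₅ a₅≥â₆ â₆≥0)
           (≤-trans (*-monoʳ-≤ â₄≥0 (^-monoˡ-≤ 0≤1 n 0≤⟦ p₄ ⟧ p₄≤p₃))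
             (*-monoˡ-≤ 0≤P[ p₃ ] a₃≥â₄))) ⟩
    ((a 0F * P p₁ + a 4F * P p₅) + a 2F * P p₃) + (a 1F * Q p₂ + (a 3F * Q p₄ + a 5F * Q p₆))
      ≈⟨ solve 6 (λ A B C D E F →
           ((A :+ E) :+ C) :+ (B :+ (D :+ F)) :=
           A :+ (B :+ (C :+ (D :+ (E :+ (F :+ con 0))))))
           refl _ _ _ _ _ _ ⟩
    a 0F * P p₁ + (a 1F * Q p₂ + (a 2F * P p₃ + (a 3F * Q p₄ + (a 4F * P p₅ + (a 5F * Q p₆ + 0#)))))
      ≈⟨ +-cong (term 0F q₁) (+-cong (term 1F q₂) (+-cong (term 2F q₃)
           (+-cong (term 3F q₄) (+-cong (term 4F q₅) (+-congʳ (term 5F q₆)))))) ⟨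
    sum (λ i → a i * product (removeAt (λ j → (x i - x j) ^ n) i)) ∎
  where
  open PartiallyOrderedCommutativeRing R
  open PartiallyOrderedCommutativeRingProperties R
  open CommutativeRing commutativeRing using (refl; trans; +-cong; +-congʳ; *-cong; *-congˡ)
  open Algebra.Properties.CommutativeSemiring.Exp (CommutativeRing.commutativeSemiring commutativeRing)
    using (^-congˡ)
  open Algebra.Solver.Ring.NaturalCoefficients.Default (CommutativeRing.commutativeSemiring commutativeRing)
    using (con; _:+_; _:=_; solve; ⟦_⟧)
  open Poset poset using () renaming (trans to ≤-trans; ≤-respʳ-≈ to ≤-respʳ)
  open ≤-Reasoning

  0≤1 : 0# ≤ 1#
  -- One is the product of the inverse and `x₂ - x₆`, both nonnegative.
  0≤1 = ≤-respʳ (proj₁ inv-inverse) (*-nonNegative _ _ (proj₁ inv>0) (x≤y⇒0≤y-x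
    (≤-trans (x↓ 4F) (≤-trans (x↓ 3F) (≤-trans (x↓ 2F) (x↓ 1F))))))

  ρ : Vec Carrier 5
  ρ = (x 4F - x 5F) ∷ ((x 0F + x 5F) - (x 1F + x 4F)) ∷ (x 3F - x 4F)
    ∷ ((x 1F + x 4F) - (x 2F + x 3F)) ∷ (x 2F - x 3F) ∷ []

  0≤ρ : ∀ i → 0# ≤ lookup ρ i
  0≤ρ 0F = x≤y⇒0≤y-x (x↓ 4F)
  0≤ρ 1F = x≤y⇒0≤y-x x₁+x₆≥x₂+x₅
  0≤ρ 2F = x≤y⇒0≤y-x (x↓ 3F)
  0≤ρ 3F = x≤y⇒0≤y-x x₂+x₅≥x₃+x₄
  0≤ρ 4F = x≤y⇒0≤y-x (x↓ 2F)

  open Gaps 0≤1 ρ 0≤ρ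

  P Q : Poly → Carrier
  P p = ⟦ p ⟧ ρ ^ n
  Q p = (- ⟦ p ⟧ ρ) ^ n

  0≤P[_] : ∀ p → 0# ≤ P p
  0≤P[ p ] = ^-nonNegative 0≤1 n 0≤⟦ p ⟧

  -- Evaluation of the differences and of the six products.

  e₃₄ : x 2F ≈ ⟦ d₃₄ ⟧ ρ + x 3F
  e₃₄ = y≈[y-x]+x _ _
  e₄₅ : x 3F ≈ ⟦ d₄₅ ⟧ ρ + x 4F
  e₄₅ = y≈[y-x]+x _ _
  e₅₆ : x 4F ≈ ⟦ d₅₆ ⟧ ρ + x 5F
  e₅₆ = y≈[y-x]+x _ _
  e₁₂ : x 0F ≈ ⟦ d₁₂ ⟧ ρ + x 1F
  e₁₂ = outer-gap e₅₆ (y≈[y-x]+x _ _)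
  e₂₃ : x 1F ≈ ⟦ d₂₃ ⟧ ρ + x 2F
  e₂₃ = outer-gap e₄₅ (y≈[y-x]+x _ _)
  e₄₆ : x 3F ≈ ⟦ d₄₆ ⟧ ρ + x 5F
  e₄₆ = chain e₄₅ e₅₆
  e₃₅ : x 2F ≈ ⟦ d₃₅ ⟧ ρ + x 4F
  e₃₅ = chain e₃₄ e₄₅
  e₃₆ : x 2F ≈ ⟦ d₃₆ ⟧ ρ + x 5F
  e₃₆ = chain e₃₅ e₅₆
  e₂₄ : x 1F ≈ ⟦ d₂₄ ⟧ ρ + x 3F
  e₂₄ = chain e₂₃ e₃₄
  e₂₅ : x 1F ≈ ⟦ d₂₅ ⟧ ρ + x 4F
  e₂₅ = chain e₂₄ e₄₅
  e₂₆ : x 1F ≈ ⟦ d₂₆ ⟧ ρ + x 5F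
  e₂₆ = chain e₂₅ e₅₆
  e₁₃ : x 0F ≈ ⟦ d₁₃ ⟧ ρ + x 2F
  e₁₃ = chain e₁₂ e₂₃
  e₁₄ : x 0F ≈ ⟦ d₁₄ ⟧ ρ + x 3F
  e₁₄ = chain e₁₃ e₃₄
  e₁₅ : x 0F ≈ ⟦ d₁₅ ⟧ ρ + x 4F
  e₁₅ = chain e₁₄ e₄₅
  e₁₆ : x 0F ≈ ⟦ d₁₆ ⟧ ρ + x 5F
  e₁₆ = chain e₁₅ e₅₆

  -- The products without the exponent, so that signs are settled before powers are taken.
  q : Fin 6 → Carrier
  q i = product (removeAt (λ j → x i - x j) i)

  -- In `q i` the factors with `j < i` are negative. Their signs are collected from the innermost
  -- such factor outwards, so the two sign rules alternate.
  q₁ : q 0F ≈ ⟦ p₁ ⟧ ρ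
  q₁ = *-cong (difference⁺ e₁₂) (*-cong (difference⁺ e₁₃) (*-cong (difference⁺ e₁₄)
    (*-cong (difference⁺ e₁₅) (*-cong (difference⁺ e₁₆) refl))))
  q₂ : q 1F ≈ - ⟦ p₂ ⟧ ρ
  q₂ = -x*y≈-[x*y] (difference⁻ e₁₂) (*-cong (difference⁺ e₂₃) (*-cong (difference⁺ e₂₄)
    (*-cong (difference⁺ e₂₅) (*-cong (difference⁺ e₂₆) refl))))
  q₃ : q 2F ≈ ⟦ p₃ ⟧ ρ
  q₃ = -x*-y≈x*y (difference⁻ e₁₃) (-x*y≈-[x*y] (difference⁻ e₂₃) (*-cong (difference⁺ e₃₄)
    (*-cong (difference⁺ e₃₅) (*-cong (difference⁺ e₃₆) refl))))
  q₄ : q 3F ≈ - ⟦ p₄ ⟧ ρ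
  q₄ = -x*y≈-[x*y] (difference⁻ e₁₄) (-x*-y≈x*y (difference⁻ e₂₄) (-x*y≈-[x*y] (difference⁻ e₃₄)
    (*-cong (difference⁺ e₄₅) (*-cong (difference⁺ e₄₆) refl))))
  q₅ : q 4F ≈ ⟦ p₅ ⟧ ρ
  q₅ = -x*-y≈x*y (difference⁻ e₁₅) (-x*y≈-[x*y] (difference⁻ e₂₅) (-x*-y≈x*y (difference⁻ e₃₅)
    (-x*y≈-[x*y] (difference⁻ e₄₅) (*-cong (difference⁺ e₅₆) refl))))
  q₆ : q 5F ≈ - ⟦ p₆ ⟧ ρ
  q₆ = -x*y≈-[x*y] (difference⁻ e₁₆) (-x*-y≈x*y (difference⁻ e₂₆) (-x*y≈-[x*y] (difference⁻ e₃₆)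
    (-x*-y≈x*y (difference⁻ e₄₆) (-x*y≈-[x*y] (difference⁻ e₅₆) refl))))

  term : ∀ i {r} → q i ≈ r → a i * product (removeAt (λ j → (x i - x j) ^ n) i) ≈ a i * r ^ n
  term i qᵢ≈r = *-congˡ (trans (product-^ (removeAt (λ j → x i - x j) i) n) (^-congˡ n qᵢ≈r))
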